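{- For every integer $n\ge 0$, $$\binom{2n+3}{n+1}C_{n+1}=\sum_{k=0}^{n}\frac{8nk+6n+14k+12}{(2n+2)(2n+3)(2n+4)}\binom{2n+3}{n-k}\binom{2n+4}{n-k+2},$$ $$\binom{2n+1}{n}C_{n+1}=\sum_{k=0}^{n}\frac{2k+2}{(2n+2)(2n+3)}\binom{2n+3}{n-k}\binom{2n+3}{n-k+1},$$ $$\binom{2n+1}{n}C_{n+2}=\sum_{k=0}^{n}\frac{8nk+10n+14k+16}{(2n+2)(2n+3)(2n+4)}\binom{2n+4}{n-k}\binom{2n+3}{n-k+1}.$$
   Context: $C_n=\frac{1}{n+1}\binom{2n}{n}$ is the $n$-th Catalan number. -}

module Defs where

open import Data.Integer using (+_)
open import Data.Nat using (ℕ; suc; _*_)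
open import Data.Nat.Combinatorics using (_C_)
open import Data.Rational as ℚ using (ℚ; _/_)
open import Data.Rational.Properties using (+-0-commutativeMonoid)

-- In  ∑[ k ≤ n ] t  the bound variable ranges over Fin (suc n), so toℕ k
-- runs over 0, …, n inclusive.
open import Algebra.Properties.CommutativeMonoid.Sum +-0-commutativeMonoid public
  using (sum⁺-syntax)

binom : ℕ → ℕ → ℚ
binom n k = + (n C k) / 1

-- Taken in ℚ, so that the division is exact by definition.
catalan : ℕ → ℚ
catalan n = (+ 1 / suc n) ℚ.* binom (2 * n) n

{-# OPTIONS --safe #-}
-- In each sum put j = n − k.  The summand is then hypergeometric in j and
-- Gosper-summable: up to a constant it is the difference Q (j + 1) − Q j of
--   Q j = j (j + s) C(N, j) C(M, j + s),
-- because Q (j + 1) = (N − j) (M − s − j) C(N, j) C(M, j + s) and the weight of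
-- the summand is proportional to (N − j) (M − s − j) − j (j + s).  As Q 0 = 0, the
-- sum is a multiple of Q (n + 1), which the absorption rules for binomial
-- coefficients identify with the product on the left.
module Submission where

open import Defs
open import Data.Fin using (toℕ)
open import Data.Integer as ℤ using (+_)
import Data.Integer.Properties as ℤ
open import Data.Nat using (ℕ; zero; suc; NonZero; _+_; _*_; _∸_)
open import Data.Nat.Combinatorics using (_C_; nC1≡n; nCk+nC[k+1]≡[n+1]C[k+1])
open import Data.Nat.Properties
open import Data.Nat.Tactic.RingSolver using (solve-∀)
open import Data.Product using (_×_; _,_)
open import Data.Rational as ℚ using (ℚ; _/_; toℚᵘ)
import Data.Rational.Properties as ℚ
open import Data.Rational.Unnormalised as ℚᵘ using (mkℚᵘ; *≡*)
import Data.Rational.Unnormalised.Properties as ℚᵘ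
open import Relation.Binary.PropositionalEquality

-- Absorption rules for binomial coefficients.

-- Induction along Pascal's rule. One copy of `x` is split off so that both remaining products fall
-- under the rule at `n`; Pascal's rule then merges them into `suc n * x`, and the copy set aside
-- makes this `suc (suc n) * x`.
absorption : ∀ n k → suc k * (suc n C suc k) ≡ suc n * (n C k)
absorption n zero = begin
  1 * (suc n C 1)  ≡⟨ *-identityˡ _ ⟩
  suc n C 1        ≡⟨ nC1≡n (suc n) ⟩
  suc n            ≡⟨ *-identityʳ (suc n) ⟨
  suc n * (n C 0)  ∎
  where open ≡-Reasoning
absorption zero (suc k) = *-zeroʳ (suc (suc k))
absorption (suc n) (suc k) = begin
  suc (suc k) * (suc (suc n) C suc (suc k))
    ≡⟨ cong (suc (suc k) *_) (nCk+nC[k+1]≡[n+1]C[k+1] (suc n) (suc k)) ⟨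
  suc (suc k) * (x + y)
    ≡⟨ *-distribˡ-+ (suc (suc k)) x y ⟩
  x + suc k * x + suc (suc k) * y
    ≡⟨ cong₂ (λ u v → x + u + v) (absorption n k) (absorption n (suc k)) ⟩
  x + suc n * (n C k) + suc n * (n C suc k)
    ≡⟨ +-assoc x _ _ ⟩
  x + (suc n * (n C k) + suc n * (n C suc k))
    ≡⟨ cong (_+_ x) (*-distribˡ-+ (suc n) (n C k) (n C suc k)) ⟨
  x + suc n * (n C k + n C suc k)
    ≡⟨ cong (λ u → x + suc n * u) (nCk+nC[k+1]≡[n+1]C[k+1] n k) ⟩
  suc (suc n) * x ∎
  where
  open ≡-Reasoning
  x = suc n C suc k
  y = suc n C suc (suc k)

-- The witness `p` stands for n - k and avoids truncated subtraction. Adding `suc k * x` turns both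
-- sides into the two sides of `absorption`.
C-suc : ∀ {n} k p → n ≡ k + p → suc k * (n C suc k) ≡ p * (n C k)
C-suc k p refl = +-cancelˡ-≡ (suc k * x) _ _ (begin
  suc k * x + suc k * y        ≡⟨ *-distribˡ-+ (suc k) x y ⟨
  suc k * (x + y)              ≡⟨ cong (suc k *_) (nCk+nC[k+1]≡[n+1]C[k+1] (k + p) k) ⟩
  suc k * (suc (k + p) C suc k) ≡⟨ absorption (k + p) k ⟩
  (suc k + p) * x              ≡⟨ *-distribʳ-+ x (suc k) p ⟩
  suc k * x + p * x            ∎)
  where
  open ≡-Reasoning
  x = (k + p) C k
  y = (k + p) C suc k

-- Fractions with natural numerators.

toℚᵘ-/ : ∀ a d .{{_ : NonZero d}} → toℚᵘ (+ a / d) ℚᵘ.≃ (+ a ℚᵘ./ d)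
toℚᵘ-/ a (suc d) = ℚ.toℚᵘ-fromℚᵘ (mkℚᵘ (+ a) d)

/-≃ : ∀ a b d e .{{_ : NonZero d}} .{{_ : NonZero e}} →
      a * e ≡ b * d → (+ a ℚᵘ./ d) ℚᵘ.≃ (+ b ℚᵘ./ e)
/-≃ a b (suc d) (suc e) eq =
  *≡* (trans (sym (ℤ.pos-* a (suc e))) (trans (cong +_ eq) (ℤ.pos-* b (suc d))))

-- Unnormalised rationals involve no gcd: the product there is a plain fraction, and comparing it
-- with c / f is cross-multiplication in ℕ, within reach of the ring solver.
/-* : ∀ a b c d e f .{{_ : NonZero d}} .{{_ : NonZero e}} .{{_ : NonZero f}} →
      a * b * f ≡ c * (d * e) → (+ a / d) ℚ.* (+ b / e) ≡ + c / f
/-* a b c d@(suc _) e@(suc _) f eq = ℚ.toℚᵘ-injective (begin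
  toℚᵘ ((+ a / d) ℚ.* (+ b / e))        ≈⟨ ℚ.toℚᵘ-homo-* (+ a / d) (+ b / e) ⟩
  toℚᵘ (+ a / d) ℚᵘ.* toℚᵘ (+ b / e)    ≈⟨ ℚᵘ.*-cong (toℚᵘ-/ a d) (toℚᵘ-/ b e) ⟩
  (+ a ℚᵘ./ d) ℚᵘ.* (+ b ℚᵘ./ e)        ≡⟨ cong (λ i → i ℚᵘ./ (d * e)) (ℤ.pos-* a b) ⟨
  + (a * b) ℚᵘ./ (d * e)                ≈⟨ /-≃ (a * b) c (d * e) f eq ⟩
  + c ℚᵘ./ f                            ≈⟨ toℚᵘ-/ c f ⟨
  toℚᵘ (+ c / f)                        ∎)
  where open ℚᵘ.≃-Reasoning

/-+ : ∀ a b d .{{_ : NonZero d}} → (+ a / d) ℚ.+ (+ b / d) ≡ + (a + b) / d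
/-+ a b d@(suc _) = ℚ.toℚᵘ-injective (begin
  toℚᵘ ((+ a / d) ℚ.+ (+ b / d))        ≈⟨ ℚ.toℚᵘ-homo-+ (+ a / d) (+ b / d) ⟩
  toℚᵘ (+ a / d) ℚᵘ.+ toℚᵘ (+ b / d)    ≈⟨ ℚᵘ.+-cong (toℚᵘ-/ a d) (toℚᵘ-/ b d) ⟩
  (+ a ℚᵘ./ d) ℚᵘ.+ (+ b ℚᵘ./ d)
    ≡⟨ cong (λ i → i ℚᵘ./ (d * d)) (cong₂ ℤ._+_ (ℤ.pos-* a d) (ℤ.pos-* b d)) ⟨
  + (a * d + b * d) ℚᵘ./ (d * d)
    ≈⟨ /-≃ (a * d + b * d) (a + b) (d * d) d (rearrange a b d) ⟩
  + (a + b) ℚᵘ./ d                      ≈⟨ toℚᵘ-/ (a + b) d ⟨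
  toℚᵘ (+ (a + b) / d)                  ∎)
  where
  open ℚᵘ.≃-Reasoning
  rearrange : ∀ a b d → (a * d + b * d) * d ≡ (a + b) * (d * d)
  rearrange = solve-∀

-- Turns a left-hand side into one fraction over a denominator of choice; `suc l` is the denominator
-- in the Catalan number.
binom*catalan : ∀ m k l x d .{{_ : NonZero d}} →
  (m C k) * ((2 * l) C l) * d ≡ x * suc l →
  binom m k ℚ.* catalan l ≡ + x / d
binom*catalan m k l x d eq = begin
  binom m k ℚ.* catalan l
    ≡⟨ cong (binom m k ℚ.*_) (/-* 1 c c (suc l) 1 (suc l) (scale c (suc l))) ⟩
  binom m k ℚ.* (+ c / suc l)
    ≡⟨ /-* (m C k) c x 1 (suc l) d (trans eq (cong (x *_) (sym (*-identityˡ (suc l))))) ⟩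
  + x / d ∎
  where
  open ≡-Reasoning
  c = (2 * l) C l
  scale : ∀ c d → 1 * c * d ≡ c * (d * 1)
  scale = solve-∀

-- Telescoping and Gosper summation.

-- The indices of `a` and `T` run in opposite directions: the first summand, k = 0, is the last
-- increment of `T`. The induction therefore shifts `a` and keeps `T` fixed.
telescope : ∀ n (a T : ℕ → ℚ) →
  (∀ j k → j + k ≡ n → a k ℚ.+ T j ≡ T (suc j)) →
  (∑[ k ≤ n ] a (toℕ k)) ℚ.+ T 0 ≡ T (suc n)
telescope zero    a T step = trans (cong (ℚ._+ T 0) (ℚ.+-identityʳ (a 0))) (step 0 0 refl)
telescope (suc n) a T step = begin
  (a 0 ℚ.+ rest) ℚ.+ T 0    ≡⟨ ℚ.+-assoc (a 0) rest (T 0) ⟩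
  a 0 ℚ.+ (rest ℚ.+ T 0)    ≡⟨ cong (a 0 ℚ.+_) (telescope n (λ k → a (suc k)) T
                                 (λ j k eq → step j (suc k) (trans (+-suc j k) (cong suc eq)))) ⟩
  a 0 ℚ.+ T (suc n)         ≡⟨ step (suc n) 0 (+-identityʳ (suc n)) ⟩
  T (suc (suc n))           ∎
  where
  open ≡-Reasoning
  rest = ∑[ k ≤ n ] a (suc (toℕ k))

-- The function Q, before scaling by a constant.
antidifference : ℕ → ℕ → ℕ → ℕ → ℕ
antidifference N M s j = j * (j + s) * ((N C j) * (M C (j + s)))

-- Each of the two linear factors is absorbed by its own binomial coefficient through `C-suc`.
antidifference-suc : ∀ {N M} s j p q → N ≡ j + p → M ≡ (j + s) + q →
  antidifference N M s (suc j) ≡ p * q * ((N C j) * (M C (j + s)))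
antidifference-suc {N} {M} s j p q N≡ M≡ = begin
  suc j * suc (j + s) * (x′ * y′)       ≡⟨ interchange (suc j) (suc (j + s)) x′ y′ ⟩
  suc j * x′ * (suc (j + s) * y′)       ≡⟨ cong₂ _*_ (C-suc j p N≡) (C-suc (j + s) q M≡) ⟩
  p * x * (q * y)                       ≡⟨ interchange p q x y ⟨
  p * q * (x * y)                       ∎
  where
  open ≡-Reasoning
  x = N C j
  x′ = N C suc j
  y = M C (j + s)
  y′ = M C suc (j + s)
  interchange : ∀ a b x y → a * b * (x * y) ≡ a * x * (b * y)
  interchange = solve-∀

-- The offsets p = N − n and q = M − s − n give N − j = k + p and M − s − j = k + q,
-- so the condition on w involves no subtraction.
∑-gosper : ∀ n N M s p q (w : ℕ → ℕ) c e D .{{_ : NonZero c}} .{{_ : NonZero D}}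
  .{{_ : NonZero (c * D)}} → N ≡ n + p → M ≡ n + s + q →
  (∀ j k → j + k ≡ n → c * w k + e * (j * (j + s)) ≡ e * ((k + p) * (k + q))) →
  ∑[ k ≤ n ] ((+ w (toℕ k) / D) ℚ.* binom N (n ∸ toℕ k) ℚ.* binom M (n ∸ toℕ k + s))
    ≡ + (e * antidifference N M s (suc n)) / (c * D)
∑-gosper n N M s p q w c e D N≡ M≡ weight = begin
  ∑a                ≡⟨ ℚ.+-identityʳ ∑a ⟨
  ∑a ℚ.+ ℚ.0ℚ       ≡⟨ cong (∑a ℚ.+_) T0≡0 ⟨
  ∑a ℚ.+ T 0        ≡⟨ telescope n a T step ⟩
  T (suc n)         ∎
  where
  open ≡-Reasoning
  a T : ℕ → ℚ
  a k = (+ w k / D) ℚ.* binom N (n ∸ k) ℚ.* binom M (n ∸ k + s)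
  -- The constant e / c is the ratio of `w k` to (k + p)(k + q) - j (j + s), and `D` is the
  -- denominator of the weight.
  T j = + (e * antidifference N M s j) / (c * D)
  ∑a = ∑[ k ≤ n ] a (toℕ k)

  T0≡0 : T 0 ≡ ℚ.0ℚ
  T0≡0 = trans (cong (λ i → + i / (c * D)) (*-zeroʳ e)) (ℚ.0/n≡0 (c * D))

  scale : ∀ w x y c D → w * x * y * (c * D) ≡ c * w * (x * y) * (D * 1)
  scale = solve-∀

  factor : ∀ c w e u z → c * w * z + e * (u * z) ≡ (c * w + e * u) * z
  factor = solve-∀

  split₁ : ∀ j k p → j + k + p ≡ j + (k + p)
  split₁ = solve-∀

  split₂ : ∀ j k s q → j + k + s + q ≡ j + s + (k + q)
  split₂ = solve-∀

  step : ∀ j k → j + k ≡ n → a k ℚ.+ T j ≡ T (suc j)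
  step j k j+k≡n = begin
    a k ℚ.+ T j
      ≡⟨ cong (λ i → (+ w k / D) ℚ.* binom N i ℚ.* binom M (i + s) ℚ.+ T j) n∸k≡j ⟩
    (+ w k / D) ℚ.* binom N j ℚ.* binom M (j + s) ℚ.+ T j
      ≡⟨ cong (λ i → i ℚ.* binom M (j + s) ℚ.+ T j) (/-* (w k) x (w k * x) D 1 D
           (cong (w k * x *_) (sym (*-identityʳ D)))) ⟩
    (+ (w k * x) / D) ℚ.* binom M (j + s) ℚ.+ T j
      -- Expanding by `c` brings the summand to the denominator of `T j`.
      ≡⟨ cong (ℚ._+ T j) (/-* (w k * x) y (c * w k * (x * y)) D 1 (c * D) (scale (w k) x y c D)) ⟩
    (+ (c * w k * (x * y)) / (c * D)) ℚ.+ T j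
      ≡⟨ /-+ (c * w k * (x * y)) (e * antidifference N M s j) (c * D) ⟩
    + (c * w k * (x * y) + e * antidifference N M s j) / (c * D)
      ≡⟨ cong (λ i → + i / (c * D)) numerator ⟩
    T (suc j) ∎
    where
    x = N C j
    y = M C (j + s)
    n∸k≡j : n ∸ k ≡ j
    n∸k≡j = trans (cong (_∸ k) (sym j+k≡n)) (m+n∸n≡m j k)
    numerator : c * w k * (x * y) + e * antidifference N M s j ≡ e * antidifference N M s (suc j)
    numerator = begin
      c * w k * (x * y) + e * (j * (j + s) * (x * y))
        ≡⟨ factor c (w k) e (j * (j + s)) (x * y) ⟩
      (c * w k + e * (j * (j + s))) * (x * y)
        ≡⟨ cong (_* (x * y)) (weight j k j+k≡n) ⟩
      e * ((k + p) * (k + q)) * (x * y)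
        ≡⟨ *-assoc e _ (x * y) ⟩
      e * ((k + p) * (k + q) * (x * y))
        ≡⟨ cong (e *_) (antidifference-suc s j (k + p) (k + q)
             (trans N≡ (trans (cong (_+ p) (sym j+k≡n)) (split₁ j k p)))
             (trans M≡ (trans (cong (λ i → i + s + q) (sym j+k≡n)) (split₂ j k s q)))) ⟨
      e * antidifference N M s (suc j) ∎

-- Matching Q (n + 1) with the products on the left.

module _ (n : ℕ) where
  private
    A = (2 + 2 * n) C (1 + n)
    B = (3 + 2 * n) C (2 + n)
    P = (1 + 2 * n) C n
    X = (3 + 2 * n) C (1 + n)

    double-suc : ∀ n → 2 * (1 + n) ≡ 2 + 2 * n
    double-suc = solve-∀

    double-suc² : ∀ n → 2 * (2 + n) ≡ 4 + 2 * n
    double-suc² = solve-∀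

  -- `X` already occurs in Q (n + 1). Two absorptions raise `A` to `B` and then to `G`, using up
  -- `3 + 2 * n` and `4 + 2 * n`; `2 + 2 * n` supplies the constant 2 and the factor `1 + n`.
  closed₁ : X * ((2 * (1 + n)) C (1 + n)) * (1 * ((2 + 2 * n) * (3 + 2 * n) * (4 + 2 * n)))
    ≡ 2 * antidifference (3 + 2 * n) (4 + 2 * n) 2 (suc n) * (2 + n)
  closed₁ = begin
    X * ((2 * (1 + n)) C (1 + n)) * (1 * ((2 + 2 * n) * (3 + 2 * n) * (4 + 2 * n)))
      ≡⟨ cong (λ m → X * (m C (1 + n)) * (1 * ((2 + 2 * n) * (3 + 2 * n) * (4 + 2 * n)))) (double-suc n) ⟩
    X * A * (1 * ((2 + 2 * n) * (3 + 2 * n) * (4 + 2 * n)))   ≡⟨ r₁ n X A ⟩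
    (2 + 2 * n) * X * (4 + 2 * n) * ((3 + 2 * n) * A)
      ≡⟨ cong ((2 + 2 * n) * X * (4 + 2 * n) *_) (absorption (2 + 2 * n) (1 + n)) ⟨
    (2 + 2 * n) * X * (4 + 2 * n) * ((2 + n) * B)             ≡⟨ r₂ n X B ⟩
    (2 + 2 * n) * X * (2 + n) * ((4 + 2 * n) * B)
      ≡⟨ cong ((2 + 2 * n) * X * (2 + n) *_) (absorption (3 + 2 * n) (2 + n)) ⟨
    (2 + 2 * n) * X * (2 + n) * ((3 + n) * G)                 ≡⟨ r₃ n X G ⟩
    2 * ((1 + n) * (3 + n) * (X * G)) * (2 + n)
      -- The shifted index `suc n + 2` computes to `1 + (n + 2)`, not to `3 + n`.
      ≡⟨ cong (λ m → 2 * ((1 + n) * (1 + m) * (X * ((4 + 2 * n) C (1 + m)))) * (2 + n)) (+-comm n 2) ⟨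
    2 * antidifference (3 + 2 * n) (4 + 2 * n) 2 (suc n) * (2 + n) ∎
    where
    open ≡-Reasoning
    G = (4 + 2 * n) C (3 + n)
    r₁ : ∀ n X A → X * A * (1 * ((2 + 2 * n) * (3 + 2 * n) * (4 + 2 * n)))
      ≡ (2 + 2 * n) * X * (4 + 2 * n) * ((3 + 2 * n) * A)
    r₁ = solve-∀
    r₂ : ∀ n X B → (2 + 2 * n) * X * (4 + 2 * n) * ((2 + n) * B)
      ≡ (2 + 2 * n) * X * (2 + n) * ((4 + 2 * n) * B)
    r₂ = solve-∀
    r₃ : ∀ n X G → (2 + 2 * n) * X * (2 + n) * ((3 + n) * G)
      ≡ 2 * ((1 + n) * (3 + n) * (X * G)) * (2 + n)
    r₃ = solve-∀

  -- Raising `A` to `B` and `Z` to `X` costs a factor `3 + 2 * n` each; the second one is the extra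
  -- factor in front of the denominator.
  closed₂ : P * ((2 * (1 + n)) C (1 + n)) * ((3 + 2 * n) * ((2 + 2 * n) * (3 + 2 * n)))
    ≡ 1 * antidifference (3 + 2 * n) (3 + 2 * n) 1 (suc n) * (2 + n)
  closed₂ = begin
    P * ((2 * (1 + n)) C (1 + n)) * ((3 + 2 * n) * ((2 + 2 * n) * (3 + 2 * n)))
      ≡⟨ cong (λ m → P * (m C (1 + n)) * ((3 + 2 * n) * ((2 + 2 * n) * (3 + 2 * n)))) (double-suc n) ⟩
    P * A * ((3 + 2 * n) * ((2 + 2 * n) * (3 + 2 * n)))       ≡⟨ r₁ n P A ⟩
    (3 + 2 * n) * ((3 + 2 * n) * A) * ((2 + 2 * n) * P)
      ≡⟨ cong₂ (λ u v → (3 + 2 * n) * u * v)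
           (sym (absorption (2 + 2 * n) (1 + n)))
           -- `P` first rises to the central coefficient `A`, whose lower index is then reduced by
           -- one to reach `Z`.
           (trans (sym (absorption (1 + 2 * n) n)) (C-suc n (2 + n) (r₂ n))) ⟩
    (3 + 2 * n) * ((2 + n) * B) * ((2 + n) * Z)               ≡⟨ r₃ n B Z ⟩
    (2 + n) * ((2 + n) * B) * ((3 + 2 * n) * Z)
      ≡⟨ cong ((2 + n) * ((2 + n) * B) *_) (absorption (2 + 2 * n) n) ⟨
    (2 + n) * ((2 + n) * B) * ((1 + n) * X)                   ≡⟨ r₄ n B X ⟩
    1 * ((1 + n) * (2 + n) * (X * B)) * (2 + n)
      ≡⟨ cong (λ m → 1 * ((1 + n) * (1 + m) * (X * ((3 + 2 * n) C (1 + m)))) * (2 + n)) (+-comm n 1) ⟨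
    1 * antidifference (3 + 2 * n) (3 + 2 * n) 1 (suc n) * (2 + n) ∎
    where
    open ≡-Reasoning
    Z = (2 + 2 * n) C n
    r₁ : ∀ n P A → P * A * ((3 + 2 * n) * ((2 + 2 * n) * (3 + 2 * n)))
      ≡ (3 + 2 * n) * ((3 + 2 * n) * A) * ((2 + 2 * n) * P)
    r₁ = solve-∀
    r₂ : ∀ n → 2 + 2 * n ≡ n + (2 + n)
    r₂ = solve-∀
    r₃ : ∀ n B Z → (3 + 2 * n) * ((2 + n) * B) * ((2 + n) * Z)
      ≡ (2 + n) * ((2 + n) * B) * ((3 + 2 * n) * Z)
    r₃ = solve-∀
    r₄ : ∀ n B X → (2 + n) * ((2 + n) * B) * ((1 + n) * X)
      ≡ 1 * ((1 + n) * (2 + n) * (X * B)) * (2 + n)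
    r₄ = solve-∀

  -- `P` rises through `A` to `B`, while `C-suc` moves the central `A′` to its neighbour `W`; the
  -- `3 + n` this releases is the Catalan denominator.
  closed₃ : P * ((2 * (2 + n)) C (2 + n)) * (1 * ((2 + 2 * n) * (3 + 2 * n) * (4 + 2 * n)))
    ≡ 2 * antidifference (4 + 2 * n) (3 + 2 * n) 1 (suc n) * (3 + n)
  closed₃ = begin
    P * ((2 * (2 + n)) C (2 + n)) * (1 * ((2 + 2 * n) * (3 + 2 * n) * (4 + 2 * n)))
      ≡⟨ cong (λ m → P * (m C (2 + n)) * (1 * ((2 + 2 * n) * (3 + 2 * n) * (4 + 2 * n)))) (double-suc² n) ⟩
    P * A′ * (1 * ((2 + 2 * n) * (3 + 2 * n) * (4 + 2 * n)))  ≡⟨ r₁ n P A′ ⟩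
    2 * (3 + 2 * n) * ((2 + 2 * n) * P) * ((2 + n) * A′)
      ≡⟨ cong₂ (λ u v → 2 * (3 + 2 * n) * u * v)
           (sym (absorption (1 + 2 * n) n))
           (C-suc (1 + n) (3 + n) (r₂ n)) ⟩
    2 * (3 + 2 * n) * ((1 + n) * A) * ((3 + n) * W)           ≡⟨ r₃ n A W ⟩
    2 * (1 + n) * ((3 + 2 * n) * A) * ((3 + n) * W)
      ≡⟨ cong (λ u → 2 * (1 + n) * u * ((3 + n) * W)) (absorption (2 + 2 * n) (1 + n)) ⟨
    2 * (1 + n) * ((2 + n) * B) * ((3 + n) * W)               ≡⟨ r₄ n B W ⟩
    2 * ((1 + n) * (2 + n) * (W * B)) * (3 + n)
      ≡⟨ cong (λ m → 2 * ((1 + n) * (1 + m) * (W * ((3 + 2 * n) C (1 + m)))) * (3 + n)) (+-comm n 1) ⟨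
    2 * antidifference (4 + 2 * n) (3 + 2 * n) 1 (suc n) * (3 + n) ∎
    where
    open ≡-Reasoning
    A′ = (4 + 2 * n) C (2 + n)
    W = (4 + 2 * n) C (1 + n)
    r₁ : ∀ n P A → P * A * (1 * ((2 + 2 * n) * (3 + 2 * n) * (4 + 2 * n)))
      ≡ 2 * (3 + 2 * n) * ((2 + 2 * n) * P) * ((2 + n) * A)
    r₁ = solve-∀
    r₂ : ∀ n → 4 + 2 * n ≡ (1 + n) + (3 + n)
    r₂ = solve-∀
    r₃ : ∀ n A W → 2 * (3 + 2 * n) * ((1 + n) * A) * ((3 + n) * W)
      ≡ 2 * (1 + n) * ((3 + 2 * n) * A) * ((3 + n) * W)
    r₃ = solve-∀
    r₄ : ∀ n B W → 2 * (1 + n) * ((2 + n) * B) * ((3 + n) * W)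
      ≡ 2 * ((1 + n) * (2 + n) * (W * B)) * (3 + n)
    r₄ = solve-∀

-- The weights as differences of products.

weight₁ : ∀ n j k → j + k ≡ n →
  1 * (8 * n * k + 6 * n + 14 * k + 12) + 2 * (j * (j + 2)) ≡ 2 * ((k + (3 + n)) * (k + (2 + n)))
weight₁ _ j k refl = identity j k
  where
  identity : ∀ j k → 1 * (8 * (j + k) * k + 6 * (j + k) + 14 * k + 12) + 2 * (j * (j + 2))
    ≡ 2 * ((k + (3 + (j + k))) * (k + (2 + (j + k))))
  identity = solve-∀

-- With u = n + k + 2 this is u (u + 1) - j (j + 1) = (u - j)(u + j + 1), where u - j = 2k + 2 and u
-- + j + 1 = 2n + 3. Hence the multiplier `3 + 2 * n`.
weight₂ : ∀ n j k → j + k ≡ n →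
  (3 + 2 * n) * (2 * k + 2) + 1 * (j * (j + 1)) ≡ 1 * ((k + (3 + n)) * (k + (2 + n)))
weight₂ _ j k refl = identity j k
  where
  identity : ∀ j k → (3 + 2 * (j + k)) * (2 * k + 2) + 1 * (j * (j + 1))
    ≡ 1 * ((k + (3 + (j + k))) * (k + (2 + (j + k))))
  identity = solve-∀

weight₃ : ∀ n j k → j + k ≡ n →
  1 * (8 * n * k + 10 * n + 14 * k + 16) + 2 * (j * (j + 1)) ≡ 2 * ((k + (4 + n)) * (k + (2 + n)))
weight₃ _ j k refl = identity j k
  where
  identity : ∀ j k → 1 * (8 * (j + k) * k + 10 * (j + k) + 14 * k + 16) + 2 * (j * (j + 1))
    ≡ 2 * ((k + (4 + (j + k))) * (k + (2 + (j + k))))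
  identity = solve-∀

corollary3p6 : (n : ℕ) →
    (binom (3 + 2 * n) (1 + n) ℚ.* catalan (1 + n)
    ≡ ∑[ k ≤ n ] (
    (+ (8 * n * toℕ k + 6 * n + 14 * toℕ k + 12) / ((2 + 2 * n) * (3 + 2 * n) * (4 + 2 * n)))
    ℚ.* binom (3 + 2 * n) (n ∸ toℕ k)
    ℚ.* binom (4 + 2 * n) (n ∸ toℕ k + 2)))
    × (binom (1 + 2 * n) n ℚ.* catalan (1 + n)
    ≡ ∑[ k ≤ n ] (
    (+ (2 * toℕ k + 2) / ((2 + 2 * n) * (3 + 2 * n)))
    ℚ.* binom (3 + 2 * n) (n ∸ toℕ k)
    ℚ.* binom (3 + 2 * n) (n ∸ toℕ k + 1)))
    × (binom (1 + 2 * n) n ℚ.* catalan (2 + n)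
    ≡ ∑[ k ≤ n ] (
    (+ (8 * n * toℕ k + 10 * n + 14 * toℕ k + 16) / ((2 + 2 * n) * (3 + 2 * n) * (4 + 2 * n)))
    ℚ.* binom (4 + 2 * n) (n ∸ toℕ k)
    ℚ.* binom (3 + 2 * n) (n ∸ toℕ k + 1)))
corollary3p6 n =
    -- Both sides become the same fraction; `1 * D` keeps the shape `c * D` produced by `∑-gosper`.
    trans (binom*catalan (3 + 2 * n) (1 + n) (1 + n)
             (2 * antidifference (3 + 2 * n) (4 + 2 * n) 2 (suc n)) (1 * D) (closed₁ n))
          (sym (∑-gosper n (3 + 2 * n) (4 + 2 * n) 2 (3 + n) (2 + n)
             (λ k → 8 * n * k + 6 * n + 14 * k + 12) 1 2 D (3+2n n) (4+2n n) (weight₁ n)))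
  , trans (binom*catalan (1 + 2 * n) n (1 + n)
             (1 * antidifference (3 + 2 * n) (3 + 2 * n) 1 (suc n)) ((3 + 2 * n) * E) (closed₂ n))
          (sym (∑-gosper n (3 + 2 * n) (3 + 2 * n) 1 (3 + n) (2 + n)
             (λ k → 2 * k + 2) (3 + 2 * n) 1 E (3+2n n) (3+2n′ n) (weight₂ n)))
  , trans (binom*catalan (1 + 2 * n) n (2 + n)
             (2 * antidifference (4 + 2 * n) (3 + 2 * n) 1 (suc n)) (1 * D) (closed₃ n))
          (sym (∑-gosper n (4 + 2 * n) (3 + 2 * n) 1 (4 + n) (2 + n)
             (λ k → 8 * n * k + 10 * n + 14 * k + 16) 1 2 D (4+2n′ n) (3+2n′ n) (weight₃ n)))
  where
  D = (2 + 2 * n) * (3 + 2 * n) * (4 + 2 * n)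
  E = (2 + 2 * n) * (3 + 2 * n)
  3+2n : ∀ n → 3 + 2 * n ≡ n + (3 + n)
  3+2n = solve-∀
  3+2n′ : ∀ n → 3 + 2 * n ≡ n + 1 + (2 + n)
  3+2n′ = solve-∀
  4+2n : ∀ n → 4 + 2 * n ≡ n + 2 + (2 + n)
  4+2n = solve-∀
  4+2n′ : ∀ n → 4 + 2 * n ≡ n + (4 + n)
  4+2n′ = solve-∀
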